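{- Let $a,b,c$ be nonzero real numbers, let $w_0,w_1$ be arbitrary real initial values, and let $\{w_n\}$ be the associated generalized bi-periodic Horadam sequence. Then for every positive integer $n$, $$w_{n+1}^2-c^2w_{n-1}^2=a^{\zeta(n)}b^{\zeta(n+1)}\left(w_1w_{2n}+c\,w_0w_{2n-1}\right).$$
   Context: For nonzero real numbers $a,b,c$ and real initial values $w_0,w_1$, the generalized bi-periodic Horadam sequence $\{w_n\}$ is defined by $w_n=\chi(n)w_{n-1}+c\,w_{n-2}$ for $n\ge 2$, where $\chi(n)=a$ if $n$ is even and $\chi(n)=b$ if $n$ is odd. The parity function is $\zeta(n)=0$ if $n$ is even and $\zeta(n)=1$ if $n$ is odd. -}

module Defs where

open import Algebra.Bundles using (CommutativeRing)
open import Data.Nat.Base as ℕ using (ℕ; suc; parity)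
import Data.Nat.Properties as ℕ
open import Data.Parity.Base using (0ℙ; 1ℙ)
open import Data.Product.Base using (_×_; _,_; ∃-syntax)
open import Data.Rational.Base as ℚ using (ℚ; 0ℚ; 1ℚ; ½; ∣_∣; 1/_; Positive; positive)
import Data.Rational.Properties as ℚ
open import Data.Rational.Solver using (module +-*-Solver)
open import Level using (0ℓ)
open import Relation.Binary.PropositionalEquality using (_≡_; refl; sym; trans; cong; subst)
open import Relation.Binary.Structures using (IsEquivalence)
open import Relation.Nullary.Negation using (¬_)

-- The real numbers, as Cauchy sequences of rationals.  There being no quotient
-- types, equality of reals is the relation _≈_ below rather than _≡_.

IsCauchy : (ℕ → ℚ) → Set
IsCauchy s = ∀ ε → 0ℚ ℚ.< ε →
  ∃[ N ] (∀ m n → N ℕ.≤ m → N ℕ.≤ n → ∣ s m ℚ.- s n ∣ ℚ.< ε)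

-- Without eta, x + y and x * y do not unfold until a term is projected out,
-- which keeps conversion checking from comparing Cauchy proofs.
record ℝ : Set where
  no-eta-equality
  field
    seq    : ℕ → ℚ
    cauchy : IsCauchy seq

open ℝ

infix 4 _≈_ _≉_

-- A record, not a function, so that x and y can be inferred from x ≈ y.
record _≈_ (x y : ℝ) : Set where
  no-eta-equality
  constructor mk≈
  field
    close : ∀ ε → 0ℚ ℚ.< ε →
      ∃[ N ] (∀ n → N ℕ.≤ n → ∣ seq x n ℚ.- seq y n ∣ ℚ.< ε)

open _≈_

_≉_ : ℝ → ℝ → Set
x ≉ y = ¬ (x ≈ y)

private

  half : ℚ → ℚ
  half ε = ε ℚ.* ½

  half>0 : ∀ ε → 0ℚ ℚ.< ε → 0ℚ ℚ.< half ε
  half>0 ε 0<ε = ℚ.positive⁻¹ (half ε) {{ℚ.pos*pos⇒pos ε {{positive 0<ε}} ½}}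

  half+half : ∀ ε → half ε ℚ.+ half ε ≡ ε
  half+half ε = trans (sym (ℚ.*-distribˡ-+ ε ½ ½)) (ℚ.*-identityʳ ε)

  ∣+∣<ε : ∀ ε p q → ∣ p ∣ ℚ.< half ε → ∣ q ∣ ℚ.< half ε → ∣ p ℚ.+ q ∣ ℚ.< ε
  ∣+∣<ε ε p q p< q< =
    ℚ.≤-<-trans (ℚ.∣p+q∣≤∣p∣+∣q∣ p q)
      (subst (∣ p ∣ ℚ.+ ∣ q ∣ ℚ.<_) (half+half ε)
        (ℚ.+-mono-< {∣ p ∣} {half ε} {∣ q ∣} {half ε} p< q<))

  ∣-∣-comm : ∀ p q → ∣ p ℚ.- q ∣ ≡ ∣ q ℚ.- p ∣
  ∣-∣-comm p q = trans (sym (ℚ.∣-p∣≡∣p∣ (p ℚ.- q)))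
    (cong ∣_∣ (solve 2 (λ p q → :- (p :- q) := q :- p) refl p q))
    where open +-*-Solver

  diff-trans : ∀ p q r → (p ℚ.- q) ℚ.+ (q ℚ.- r) ≡ p ℚ.- r
  diff-trans = solve 3 (λ p q r → (p :- q) :+ (q :- r) := p :- r) refl
    where open +-*-Solver

  diff-+ : ∀ p q p′ q′ → (p ℚ.- p′) ℚ.+ (q ℚ.- q′) ≡ (p ℚ.+ q) ℚ.- (p′ ℚ.+ q′)
  diff-+ = solve 4 (λ p q p′ q′ → (p :- p′) :+ (q :- q′) := (p :+ q) :- (p′ :+ q′)) refl
    where open +-*-Solver

  diff-* : ∀ p q p′ q′ →
    p ℚ.* (q ℚ.- q′) ℚ.+ q′ ℚ.* (p ℚ.- p′) ≡ p ℚ.* q ℚ.- p′ ℚ.* q′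
  diff-* = solve 4 (λ p q p′ q′ →
    p :* (q :- q′) :+ q′ :* (p :- p′) := p :* q :- p′ :* q′) refl
    where open +-*-Solver

  diff-neg : ∀ p q → ℚ.- p ℚ.- ℚ.- q ≡ q ℚ.- p
  diff-neg = solve 2 (λ p q → :- p :- (:- q) := q :- p) refl
    where open +-*-Solver

  diff-restore : ∀ p q → (p ℚ.- q) ℚ.+ q ≡ p
  diff-restore = solve 2 (λ p q → (p :- q) :+ q := p) refl
    where open +-*-Solver

  shrink : ∀ B → 0ℚ ℚ.< B → ℚ → ℚ
  shrink B 0<B ε = ((1/ B) {{ℚ.pos⇒nonZero B {{positive 0<B}}}}) ℚ.* ε

  shrink>0 : ∀ B (0<B : 0ℚ ℚ.< B) ε → 0ℚ ℚ.< ε → 0ℚ ℚ.< shrink B 0<B ε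
  shrink>0 B 0<B ε 0<ε = ℚ.positive⁻¹ (shrink B 0<B ε)
    {{ℚ.pos*pos⇒pos ((1/ B) {{B≢0}}) {{ℚ.1/pos⇒pos B {{positive 0<B}}}} ε {{positive 0<ε}}}}
    where
    B≢0 : ℚ.NonZero B
    B≢0 = ℚ.pos⇒nonZero B {{positive 0<B}}

  ∣*∣<ε : ∀ B (0<B : 0ℚ ℚ.< B) ε p q →
    ∣ p ∣ ℚ.< B → ∣ q ∣ ℚ.< shrink B 0<B ε → ∣ p ℚ.* q ∣ ℚ.< ε
  ∣*∣<ε B 0<B ε p q p< q< = begin-strict
    ∣ p ℚ.* q ∣             ≡⟨ ℚ.∣p*q∣≡∣p∣*∣q∣ p q ⟩
    ∣ p ∣ ℚ.* ∣ q ∣         ≤⟨ ℚ.*-monoʳ-≤-nonNeg ∣ q ∣ {{ℚ.nonNegative (ℚ.0≤∣p∣ q)}} {∣ p ∣} {B} (ℚ.<⇒≤ p<) ⟩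
    B ℚ.* ∣ q ∣             <⟨ ℚ.*-monoʳ-<-pos B {∣ q ∣} {shrink B 0<B ε} q< ⟩
    B ℚ.* (1/ B ℚ.* ε)      ≡⟨ ℚ.*-assoc B (1/ B) ε ⟨
    (B ℚ.* 1/ B) ℚ.* ε      ≡⟨ cong (ℚ._* ε) (ℚ.*-inverseʳ B) ⟩
    1ℚ ℚ.* ε                ≡⟨ ℚ.*-identityˡ ε ⟩
    ε                       ∎
    where
    open ℚ.≤-Reasoning
    instance
      B-pos : Positive B
      B-pos = positive 0<B
      B≢0 : ℚ.NonZero B
      B≢0 = ℚ.pos⇒nonZero B

  trans-close : ∀ ε p q r → ∣ p ℚ.- q ∣ ℚ.< half ε → ∣ q ℚ.- r ∣ ℚ.< half ε →
    ∣ p ℚ.- r ∣ ℚ.< ε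
  trans-close ε p q r h k = subst (λ d → ∣ d ∣ ℚ.< ε) (diff-trans p q r)
    (∣+∣<ε ε (p ℚ.- q) (q ℚ.- r) h k)

  neg-close : ∀ ε p q → ∣ p ℚ.- q ∣ ℚ.< ε → ∣ ℚ.- p ℚ.- ℚ.- q ∣ ℚ.< ε
  neg-close ε p q = subst (ℚ._< ε)
    (trans (∣-∣-comm p q) (cong ∣_∣ (sym (diff-neg p q))))

  +-close : ∀ ε p q p′ q′ → ∣ p ℚ.- p′ ∣ ℚ.< half ε → ∣ q ℚ.- q′ ∣ ℚ.< half ε →
    ∣ (p ℚ.+ q) ℚ.- (p′ ℚ.+ q′) ∣ ℚ.< ε
  +-close ε p q p′ q′ h k = subst (λ d → ∣ d ∣ ℚ.< ε) (diff-+ p q p′ q′)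
    (∣+∣<ε ε (p ℚ.- p′) (q ℚ.- q′) h k)

  *-close : ∀ ε B (0<B : 0ℚ ℚ.< B) C (0<C : 0ℚ ℚ.< C) p q p′ q′ →
    ∣ p ∣ ℚ.< B → ∣ q′ ∣ ℚ.< C →
    ∣ p ℚ.- p′ ∣ ℚ.< shrink C 0<C (half ε) → ∣ q ℚ.- q′ ∣ ℚ.< shrink B 0<B (half ε) →
    ∣ p ℚ.* q ℚ.- p′ ℚ.* q′ ∣ ℚ.< ε
  *-close ε B 0<B C 0<C p q p′ q′ p< q′< h k =
    subst (λ d → ∣ d ∣ ℚ.< ε) (diff-* p q p′ q′)
      (∣+∣<ε ε (p ℚ.* (q ℚ.- q′)) (q′ ℚ.* (p ℚ.- p′))
        (∣*∣<ε B 0<B (half ε) p (q ℚ.- q′) p< k)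
        (∣*∣<ε C 0<C (half ε) q′ (p ℚ.- p′) q′< h))

  0<1 : 0ℚ ℚ.< 1ℚ
  0<1 = ℚ.positive⁻¹ 1ℚ

  bounded : ∀ x → ∃[ B ] (0ℚ ℚ.< B × ∃[ N ] (∀ n → N ℕ.≤ n → ∣ seq x n ∣ ℚ.< B))
  bounded x with cauchy x 1ℚ 0<1
  ... | N , h = 1ℚ ℚ.+ ∣ seq x N ∣
              , ℚ.+-mono-<-≤ 0<1 (ℚ.0≤∣p∣ (seq x N))
              , N , λ n N≤n → ℚ.≤-<-trans
                  (subst (λ p → ∣ p ∣ ℚ.≤ ∣ seq x n ℚ.- seq x N ∣ ℚ.+ ∣ seq x N ∣)
                    (diff-restore (seq x n) (seq x N))
                    (ℚ.∣p+q∣≤∣p∣+∣q∣ (seq x n ℚ.- seq x N) (seq x N)))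
                  (ℚ.+-monoˡ-< ∣ seq x N ∣ (h n N N≤n ℕ.≤-refl))

  ≤⊔ˡ : ∀ m n {o} → m ℕ.⊔ n ℕ.≤ o → m ℕ.≤ o
  ≤⊔ˡ m n = ℕ.m⊔n≤o⇒m≤o m n

  ≤⊔ʳ : ∀ m n {o} → m ℕ.⊔ n ℕ.≤ o → n ℕ.≤ o
  ≤⊔ʳ m n = ℕ.m⊔n≤o⇒n≤o m n

  pointwise : ∀ {x y} → (∀ n → seq x n ≡ seq y n) → x ≈ y
  pointwise {x} {y} eq .close ε 0<ε = 0 , λ n _ →
    subst (λ p → ∣ p ∣ ℚ.< ε)
      (sym (trans (cong (ℚ._- seq y n) (eq n)) (ℚ.+-inverseʳ (seq y n)))) 0<ε

fromℚ : ℚ → ℝ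
fromℚ p .seq _ = p
fromℚ p .cauchy ε 0<ε = 0 , λ _ _ _ _ →
  subst (λ q → ∣ q ∣ ℚ.< ε) (sym (ℚ.+-inverseʳ p)) 0<ε

0ℝ 1ℝ : ℝ
0ℝ = fromℚ 0ℚ
1ℝ = fromℚ 1ℚ

infixl 6 _+_ _-_
infixl 7 _*_
infix  8 -_

_+_ : ℝ → ℝ → ℝ
(x + y) .seq n = seq x n ℚ.+ seq y n
(x + y) .cauchy ε 0<ε =
  let M , h = cauchy x (half ε) (half>0 ε 0<ε)
      N , k = cauchy y (half ε) (half>0 ε 0<ε)
  in M ℕ.⊔ N , λ m n ≤m ≤n →
    +-close ε (seq x m) (seq y m) (seq x n) (seq y n)
      (h m n (≤⊔ˡ M N ≤m) (≤⊔ˡ M N ≤n)) (k m n (≤⊔ʳ M N ≤m) (≤⊔ʳ M N ≤n))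

-_ : ℝ → ℝ
(- x) .seq n = ℚ.- seq x n
(- x) .cauchy ε 0<ε =
  let N , h = cauchy x ε 0<ε
  in N , λ m n ≤m ≤n → neg-close ε (seq x m) (seq x n) (h m n ≤m ≤n)

_-_ : ℝ → ℝ → ℝ
x - y = x + - y

_*_ : ℝ → ℝ → ℝ
(x * y) .seq n = seq x n ℚ.* seq y n
(x * y) .cauchy ε 0<ε =
  let B , 0<B , K , x< = bounded x
      C , 0<C , L , y< = bounded y
      M , h = cauchy x (shrink C 0<C (half ε)) (shrink>0 C 0<C (half ε) (half>0 ε 0<ε))
      N , k = cauchy y (shrink B 0<B (half ε)) (shrink>0 B 0<B (half ε) (half>0 ε 0<ε))
  in (K ℕ.⊔ L) ℕ.⊔ (M ℕ.⊔ N) , λ m n ≤m ≤n →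
    let ≤m′ = ≤⊔ʳ (K ℕ.⊔ L) (M ℕ.⊔ N) ≤m
        ≤n′ = ≤⊔ʳ (K ℕ.⊔ L) (M ℕ.⊔ N) ≤n
    in *-close ε B 0<B C 0<C (seq x m) (seq y m) (seq x n) (seq y n)
      (x< m (≤⊔ˡ K L (≤⊔ˡ (K ℕ.⊔ L) (M ℕ.⊔ N) ≤m)))
      (y< n (≤⊔ʳ K L (≤⊔ˡ (K ℕ.⊔ L) (M ℕ.⊔ N) ≤n)))
      (h m n (≤⊔ˡ M N ≤m′) (≤⊔ˡ M N ≤n′)) (k m n (≤⊔ʳ M N ≤m′) (≤⊔ʳ M N ≤n′))

private

  ≈-isEquivalence : IsEquivalence _≈_
  ≈-isEquivalence = record
    { refl  = pointwise λ _ → refl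
    ; sym   = λ {x} {y} x≈y → mk≈ λ ε 0<ε → let N , h = close x≈y ε 0<ε in
        N , λ n N≤n → subst (ℚ._< ε) (∣-∣-comm (seq x n) (seq y n)) (h n N≤n)
    ; trans = λ {x} {y} {z} x≈y y≈z → mk≈ λ ε 0<ε →
        let M , h = close x≈y (half ε) (half>0 ε 0<ε)
            N , k = close y≈z (half ε) (half>0 ε 0<ε)
        in M ℕ.⊔ N , λ n ≤n →
          trans-close ε (seq x n) (seq y n) (seq z n) (h n (≤⊔ˡ M N ≤n)) (k n (≤⊔ʳ M N ≤n))
    }

  +-cong : ∀ {x x′ y y′} → x ≈ x′ → y ≈ y′ → x + y ≈ x′ + y′
  +-cong {x} {x′} {y} {y′} x≈x′ y≈y′ .close ε 0<ε =
    let M , h = close x≈x′ (half ε) (half>0 ε 0<ε)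
        N , k = close y≈y′ (half ε) (half>0 ε 0<ε)
    in M ℕ.⊔ N , λ n ≤n →
      +-close ε (seq x n) (seq y n) (seq x′ n) (seq y′ n)
        (h n (≤⊔ˡ M N ≤n)) (k n (≤⊔ʳ M N ≤n))

  -‿cong : ∀ {x y} → x ≈ y → - x ≈ - y
  -‿cong {x} {y} x≈y .close ε 0<ε =
    let N , h = close x≈y ε 0<ε
    in N , λ n ≤n → neg-close ε (seq x n) (seq y n) (h n ≤n)

  *-cong : ∀ {x x′ y y′} → x ≈ x′ → y ≈ y′ → x * y ≈ x′ * y′
  *-cong {x} {x′} {y} {y′} x≈x′ y≈y′ .close ε 0<ε =
    let B , 0<B , K , x< = bounded x
        C , 0<C , L , y′< = bounded y′
        M , h = close x≈x′ (shrink C 0<C (half ε)) (shrink>0 C 0<C (half ε) (half>0 ε 0<ε))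
        N , k = close y≈y′ (shrink B 0<B (half ε)) (shrink>0 B 0<B (half ε) (half>0 ε 0<ε))
    in (K ℕ.⊔ L) ℕ.⊔ (M ℕ.⊔ N) , λ n ≤n →
      let ≤n₁ = ≤⊔ˡ (K ℕ.⊔ L) (M ℕ.⊔ N) ≤n
          ≤n₂ = ≤⊔ʳ (K ℕ.⊔ L) (M ℕ.⊔ N) ≤n
      in *-close ε B 0<B C 0<C (seq x n) (seq y n) (seq x′ n) (seq y′ n)
        (x< n (≤⊔ˡ K L ≤n₁)) (y′< n (≤⊔ʳ K L ≤n₁))
        (h n (≤⊔ˡ M N ≤n₂)) (k n (≤⊔ʳ M N ≤n₂))

ℝ-commutativeRing : CommutativeRing 0ℓ 0ℓ
ℝ-commutativeRing = record
  { Carrier = ℝ ; _≈_ = _≈_ ; _+_ = _+_ ; _*_ = _*_ ; -_ = -_ ; 0# = 0ℝ ; 1# = 1ℝ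
  ; isCommutativeRing = record
    { isRing = record
      { +-isAbelianGroup = record
        { isGroup = record
          { isMonoid = record
            { isSemigroup = record
              { isMagma = record { isEquivalence = ≈-isEquivalence ; ∙-cong = +-cong }
              ; assoc = λ x y z → pointwise λ n → ℚ.+-assoc (seq x n) (seq y n) (seq z n)
              }
            ; identity = (λ x → pointwise λ n → ℚ.+-identityˡ (seq x n))
                       , (λ x → pointwise λ n → ℚ.+-identityʳ (seq x n))
            }
          ; inverse = (λ x → pointwise λ n → ℚ.+-inverseˡ (seq x n))
                    , (λ x → pointwise λ n → ℚ.+-inverseʳ (seq x n))
          ; ⁻¹-cong = -‿cong
          }
        ; comm = λ x y → pointwise λ n → ℚ.+-comm (seq x n) (seq y n)
        }
      ; *-cong = *-cong
      ; *-assoc = λ x y z → pointwise λ n → ℚ.*-assoc (seq x n) (seq y n) (seq z n)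
      ; *-identity = (λ x → pointwise λ n → ℚ.*-identityˡ (seq x n))
                   , (λ x → pointwise λ n → ℚ.*-identityʳ (seq x n))
      ; distrib = (λ x y z → pointwise λ n → ℚ.*-distribˡ-+ (seq x n) (seq y n) (seq z n))
                , (λ x y z → pointwise λ n → ℚ.*-distribʳ-+ (seq x n) (seq y n) (seq z n))
      }
    ; *-comm = λ x y → pointwise λ n → ℚ.*-comm (seq x n) (seq y n)
    }
  }

open import Algebra.Properties.Semiring.Exp
  (CommutativeRing.semiring ℝ-commutativeRing) public using (_^_)

ζ : ℕ → ℕ
ζ n with parity n
... | 0ℙ = 0
... | 1ℙ = 1

χ : ℝ → ℝ → ℕ → ℝ
χ a b n with parity n
... | 0ℙ = a
... | 1ℙ = b

horadam : (a b c w₀ w₁ : ℝ) → ℕ → ℝ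
horadam a b c w₀ w₁ 0 = w₀
horadam a b c w₀ w₁ 1 = w₁
horadam a b c w₀ w₁ (suc (suc n)) =
  χ a b (suc (suc n)) * horadam a b c w₀ w₁ (suc n) + c * horadam a b c w₀ w₁ n

{-# OPTIONS --safe #-}

-- Put F k m = w (k + 1) w (m + 1) + c (w k) (w m).  Expanding one factor by the
-- recurrence gives F k (m + 1) = F (k + 1) m whenever k and m have the same
-- parity, since then χ (m + 2) = χ (k + 2).  Hence F 0 (2 n - 1) = F (n - 1) n,
-- that is, w₁ w (2 n) + c w₀ w (2 n - 1) = w n (w (n + 1) + c w (n - 1)).
-- Multiplying by χ (n + 1) and using χ (n + 1) w n = w (n + 1) - c w (n - 1)
-- leaves a difference of squares.

module Submission where

open import Defs
open import Algebra.Bundles using (CommutativeRing)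
open import Data.Nat.Base as ℕ using (ℕ; zero; suc; parity; _∸_)
open import Data.Nat.Properties as ℕ using (+-suc; +-identityʳ)
open import Data.Parity.Base using (0ℙ; 1ℙ)
open import Data.Product.Base using (_,_)
open import Data.Rational.Base as ℚ using (0ℚ; 1ℚ; ∣_∣)
import Data.Rational.Properties as ℚ
open import Data.Rational.Solver using (module +-*-Solver)
open import Relation.Binary.PropositionalEquality using (_≡_; refl; sym; trans; cong; subst)

open CommutativeRing ℝ-commutativeRing
  using (setoid; *-congˡ; *-congʳ; *-identityˡ; *-identityʳ)
  renaming (refl to ≈-refl; sym to ≈-sym; trans to ≈-trans)

open import Relation.Binary.Reasoning.Setoid setoid

open +-*-Solver
open ℝ using (seq)

-- Zero is not decidable on ℝ, so a ring solver over ℝ itself could not cancel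
-- terms; polynomial identities are transported from ℚ along this lemma instead.
seq-≡⇒≈ : ∀ {x y} → (∀ n → seq x n ≡ seq y n) → x ≈ y
seq-≡⇒≈ {x} {y} eq = mk≈ λ ε 0<ε → 0 , λ n _ →
  subst (λ p → ∣ p ∣ ℚ.< ε)
    (sym (trans (cong (ℚ._- seq y n) (eq n)) (ℚ.+-inverseʳ (seq y n)))) 0<ε

parity-double-+ : ∀ j i → parity (j ℕ.+ j ℕ.+ i) ≡ parity i
parity-double-+ zero    i = refl
parity-double-+ (suc j) i rewrite +-suc j j = parity-double-+ j i

χ-cong-parity : ∀ a b {m n} → parity m ≡ parity n → χ a b m ≡ χ a b n
χ-cong-parity a b {m} {n} eq with parity m | parity n
χ-cong-parity a b refl | 0ℙ | .0ℙ = refl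
χ-cong-parity a b refl | 1ℙ | .1ℙ = refl

ζ-cong-parity : ∀ {m n} → parity m ≡ parity n → ζ m ≡ ζ n
ζ-cong-parity {m} {n} eq with parity m | parity n
ζ-cong-parity refl | 0ℙ | .0ℙ = refl
ζ-cong-parity refl | 1ℙ | .1ℙ = refl

-- Both sides have period two in `n`, so the cases 0 and 1 decide everything; in each, one of the
-- two powers is `1ℝ`.
χ-suc : ∀ a b n → χ a b (suc n) ≈ a ^ ζ n * b ^ ζ (suc n)
χ-suc a b 0 = ≈-sym (≈-trans (*-identityˡ (b * 1ℝ)) (*-identityʳ b))
χ-suc a b 1 = ≈-sym (≈-trans (*-identityʳ (a * 1ℝ)) (*-identityʳ a))
χ-suc a b (suc (suc n))
  rewrite χ-cong-parity a b {suc (suc (suc n))} {suc n} refl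
        | ζ-cong-parity {suc (suc n)} {n} refl
        | ζ-cong-parity {suc (suc (suc n))} {suc n} refl
  = χ-suc a b n

module _ (a b c w₀ w₁ : ℝ) where

  private
    w : ℕ → ℝ
    w = horadam a b c w₀ w₁

  F : ℕ → ℕ → ℝ
  F k m = w (suc k) * w (suc m) + c * w k * w m

  F-shift : ∀ k m → parity k ≡ parity m → F k (suc m) ≈ F (suc k) m
  -- Once both recurrences share one coefficient, the claim is a polynomial identity.
  F-shift k m eq rewrite χ-cong-parity a b {suc (suc k)} {suc (suc m)} eq =
    exchange (χ a b (suc (suc m))) (w (suc k)) (w k) (w (suc m)) (w m)
    where
    exchange : ∀ x p q r s →
      p * (x * r + c * s) + c * q * r ≈ (x * p + c * q) * r + c * p * s
    exchange x p q r s = seq-≡⇒≈ λ n →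
      solve 6 (λ x p q r s c →
        p :* (x :* r :+ c :* s) :+ c :* q :* r := (x :* p :+ c :* q) :* r :+ c :* p :* s)
        refl (seq x n) (seq p n) (seq q n) (seq r n) (seq s n) (seq c n)

  -- Each `F-shift` moves one unit between the indices and so narrows their gap by two, preserving
  -- equal parity for the next shift. The offset `i` lets the induction go through, since the first
  -- index grows.
  F-balance : ∀ j i → F i (suc (j ℕ.+ j ℕ.+ i)) ≈ F (j ℕ.+ i) (suc (j ℕ.+ i))
  F-balance zero    i = ≈-refl
  F-balance (suc j) i = begin
    F i (suc (suc j ℕ.+ suc j ℕ.+ i))
      ≈⟨ F-shift i (suc j ℕ.+ suc j ℕ.+ i) (sym (parity-double-+ (suc j) i)) ⟩
    F (suc i) (suc j ℕ.+ suc j ℕ.+ i)      ≡⟨ cong (F (suc i)) reindex ⟩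
    F (suc i) (suc (j ℕ.+ j ℕ.+ suc i))    ≈⟨ F-balance j (suc i) ⟩
    F (j ℕ.+ suc i) (suc (j ℕ.+ suc i))    ≡⟨ cong (λ m → F m (suc m)) (+-suc j i) ⟩
    F (suc j ℕ.+ i) (suc (suc j ℕ.+ i))    ∎
    where
    reindex : suc j ℕ.+ suc j ℕ.+ i ≡ suc (j ℕ.+ j ℕ.+ suc i)
    reindex rewrite +-suc j j | +-suc (j ℕ.+ j) i = refl

  F-double : ∀ p → F p (suc p) ≈ w₁ * w (2 ℕ.* suc p) + c * w₀ * w (2 ℕ.* suc p ∸ 1)
  F-double p = begin
    F p (suc p)                  ≡⟨ cong (λ m → F m (suc m)) (+-identityʳ p) ⟨
    F (p ℕ.+ 0) (suc (p ℕ.+ 0))  ≈⟨ F-balance p 0 ⟨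
    F 0 (suc (p ℕ.+ p ℕ.+ 0))    ≡⟨ cong (F 0) reindex ⟩
    -- The index is the normal form of `2 * suc p ∸ 1`, so this unfolds to the stated right side.
    F 0 (p ℕ.+ suc (p ℕ.+ 0))    ∎
    where
    reindex : suc (p ℕ.+ p ℕ.+ 0) ≡ p ℕ.+ suc (p ℕ.+ 0)
    reindex rewrite +-suc p (p ℕ.+ 0) | ℕ.+-assoc p p 0 = refl

  difference-of-squares : ∀ p →
    w (suc (suc p)) ^ 2 - c ^ 2 * w p ^ 2 ≈ χ a b (suc (suc p)) * F p (suc p)
  difference-of-squares p = factor (χ a b (suc (suc p))) (w (suc p)) (w p)
    where
    factor : ∀ x r s →
      (x * r + c * s) ^ 2 - c ^ 2 * s ^ 2 ≈ x * (r * (x * r + c * s) + c * s * r)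
    factor x r s = seq-≡⇒≈ λ n →
      -- `con 1ℚ` is the final factor one in the unfolding of `_^_`.
      solve 4 (λ x r s c → let y = x :* r :+ c :* s in
        y :* (y :* con 1ℚ) :- c :* (c :* con 1ℚ) :* (s :* (s :* con 1ℚ))
          := x :* (r :* y :+ c :* s :* r))
        refl (seq x n) (seq r n) (seq s n) (seq c n)

theorem6 : (a b c : ℝ) → a ≉ 0ℝ → b ≉ 0ℝ → c ≉ 0ℝ →
    (w₀ w₁ : ℝ) →
    let w = horadam a b c w₀ w₁ in
    (n : ℕ) → n ℕ.≥ 1 →
    w (n ℕ.+ 1) ^ 2 - c ^ 2 * w (n ∸ 1) ^ 2
    ≈ a ^ ζ n * b ^ ζ (n ℕ.+ 1) * (w₁ * w (2 ℕ.* n) + c * w₀ * w (2 ℕ.* n ∸ 1))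
-- The rewrite turns `p + 1` into `suc p`, exposing the index `suc (suc p)` at which the recurrence
-- unfolds.
theorem6 a b c _ _ _ w₀ w₁ (suc p) _ rewrite ℕ.+-comm p 1 =
  ≈-trans (difference-of-squares a b c w₀ w₁ p)
    (≈-trans (*-congʳ (χ-suc a b (suc p))) (*-congˡ (F-double a b c w₀ w₁ p)))
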